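{- Let $p$ be a prime, let $F\colon\mathbb{F}_p^n\to\mathbb{F}_p^m$ be an almost balanced surjective bent function and let $L\colon\mathbb{F}_p^m\to\mathbb{F}_p^k$ be a surjective linear mapping. Then: 1. If $F$ is of type $(+)$, then $L\circ F\colon\mathbb{F}_p^n\to\mathbb{F}_p^k$ is almost balanced of type $(+)$ as well. 2. If $F$ is of type $(-)$, then $L\circ F\colon\mathbb{F}_p^n\to\mathbb{F}_p^k$ is almost balanced of type $(-)$ as well. Consequently, if $F$ is of type $(+)$ (resp. type $(-)$), then every component bent function $x\mapsto\langle b,F(x)\rangle$, $b\in\mathbb{F}_p^m\setminus\{0\}$, is of type $(+)$ (resp. type $(-)$).
   Context: $\langle\cdot,\cdot\rangle$ is the standard scalar product on $\mathbb{F}_p^m$. A function $F\colon\mathbb{F}_p^n\to\mathbb{F}_p^m$ is bent (perfect nonlinear) if $|\{x: F(x+a)-F(x)=b\}|=p^{n-m}$ for all nonzero $a$ and all $b$. A bent function $F\colon\mathbb{F}_p^n\to\mathbb{F}_p^m$ is almost balanced of type $(+)$ if for some $\alpha\in\mathbb{F}_p^m$, $|F^{ -1}(\alpha)|=p^{n-m}+p^{n/2}-p^{n/2-m}$ and $|F^{ -1}(\beta)|=p^{n-m}-p^{n/2-m}$ for all $\beta\neq\alpha$; it is almost balanced of type $(-)$ if for some $\alpha$, $|F^{ -1}(\alpha)|=p^{n-m}-p^{n/2}+p^{n/2-m}$ and $|F^{ -1}(\beta)|=p^{n-m}+p^{n/2-m}$ for all $\beta\neq\alpha$. It is almost balanced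 if it is of type $(+)$ or $(-)$. For functions into $\mathbb{F}_p^k$ (or $\mathbb{F}_p$) replace $m$ by $k$ (or $1$). -}

module Defs where

open import Algebra.Module.Bundles.Raw using (RawLeftModule)
open import Algebra.Module.Morphism.Structures using (module LeftModuleMorphisms)
open import Data.Fin.Base using (Fin; toℕ)
import Data.Fin.Properties as Fin
open import Data.Integer.Base as ℤ using (ℤ; +_; -[1+_])
open import Data.List.Base using (List; length; filter; allFin; cartesianProductWith)
import Data.List.Base as List
open import Data.Nat.Base as ℕ using (ℕ; zero; suc; NonZero)
open import Data.Nat.DivMod using (_mod_)
import Data.Nat.Properties as ℕ
open import Data.Product.Base using (_×_; ∃-syntax)
open import Data.Rational.Base as ℚ using (ℚ)
open import Data.Sum.Base using (_⊎_)
open import Data.Vec.Base using (Vec; []; _∷_; map; zipWith; replicate; foldr′)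
import Data.Vec.Properties as Vec
open import Level using (0ℓ)
open import Relation.Binary.Definitions using (DecidableEquality)
open import Relation.Binary.PropositionalEquality.Core using (_≡_; _≢_)
open import Relation.Unary using (Pred; Decidable)

-- Residues modulo p; this is the field with p elements when p is prime.
𝔽 : ℕ → Set
𝔽 p = Fin p

infixl 8 _^_
_^_ : Set → ℕ → Set
A ^ n = Vec A n

infix 4 _≟_
_≟_ : ∀ {p n} → DecidableEquality (𝔽 p ^ n)
_≟_ = Vec.≡-dec Fin._≟_

module _ {p : ℕ} .{{_ : NonZero p}} where

  infixl 6 _+ₚ_
  infixl 7 _*ₚ_

  0ₚ : 𝔽 p
  0ₚ = 0 mod p

  _+ₚ_ _*ₚ_ : 𝔽 p → 𝔽 p → 𝔽 p
  x +ₚ y = (toℕ x ℕ.+ toℕ y) mod p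
  x *ₚ y = (toℕ x ℕ.* toℕ y) mod p

  -ₚ_ : 𝔽 p → 𝔽 p
  -ₚ x = (p ℕ.∸ toℕ x) mod p

  infixl 6 _+ᵥ_ _-ᵥ_
  infixr 7 _*ᵥ_

  0ᵥ : ∀ {n} → 𝔽 p ^ n
  0ᵥ = replicate _ 0ₚ

  _+ᵥ_ _-ᵥ_ : ∀ {n} → 𝔽 p ^ n → 𝔽 p ^ n → 𝔽 p ^ n
  u +ᵥ v = zipWith _+ₚ_ u v
  u -ᵥ v = u +ᵥ map -ₚ_ v

  _*ᵥ_ : ∀ {n} → 𝔽 p → 𝔽 p ^ n → 𝔽 p ^ n
  c *ᵥ v = map (c *ₚ_) v

  ⟨_,_⟩ : ∀ {n} → 𝔽 p ^ n → 𝔽 p ^ n → 𝔽 p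
  ⟨ u , v ⟩ = foldr′ _+ₚ_ 0ₚ (zipWith _*ₚ_ u v)

  space : ℕ → RawLeftModule (𝔽 p) 0ℓ 0ℓ
  space n = record
    { Carrierᴹ = 𝔽 p ^ n
    ; _≈ᴹ_     = _≡_
    ; _+ᴹ_     = _+ᵥ_
    ; _*ₗ_     = _*ᵥ_
    ; 0ᴹ       = 0ᵥ
    ; -ᴹ_      = map -ₚ_
    }

  IsLinear : ∀ {m k} → (𝔽 p ^ m → 𝔽 p ^ k) → Set
  IsLinear {m} {k} = LeftModuleMorphisms.IsLeftModuleHomomorphism (space m) (space k)

-- Every vector occurs exactly once in this list.
allVectors : ∀ p n → List (𝔽 p ^ n)
allVectors p zero    = List.[ [] ]
allVectors p (suc n) = cartesianProductWith _∷_ (allFin p) (allVectors p n)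

-- The number of x with P x, as a rational so that it can be compared with
-- expressions containing possibly negative powers of p.
#_ : ∀ {p n} {P : Pred (𝔽 p ^ n) 0ℓ} → Decidable P → ℚ
#_ {p} {n} P? = + length (filter P? (allVectors p n)) ℚ./ 1

pow : (p : ℕ) .{{_ : NonZero p}} → ℤ → ℚ
pow p (+ e)    = + (p ℕ.^ e) ℚ./ 1
pow p -[1+ e ] = ℚ._/_ (+ 1) (p ℕ.^ suc e) {{ℕ.m^n≢0 p (suc e)}}

module _ {p : ℕ} .{{_ : NonZero p}} {n m : ℕ} (F : 𝔽 p ^ n → 𝔽 p ^ m) where

  Bent : Set
  Bent = ∀ a → a ≢ 0ᵥ → ∀ b →
    # (λ x → F (x +ᵥ a) -ᵥ F x ≟ b) ≡ pow p (+ n ℤ.- + m)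

  fibreSize : 𝔽 p ^ m → ℚ
  fibreSize β = # (λ x → F x ≟ β)

  -- In the two types below h is n/2.  If n is odd and m ≥ 1, then
  -- p^(n/2) - p^(n/2-m) is irrational, so the fibre sizes cannot have the
  -- required values; hence n is taken to be even.  (For m = 0, where the two
  -- powers cancel, this leaves out the constant map on a space of odd dimension.)
  AlmostBalanced⁺ : Set
  AlmostBalanced⁺ = Bent × ∃[ h ] (n ≡ 2 ℕ.* h × ∃[ α ]
    ( fibreSize α ≡ pow p (+ n ℤ.- + m) ℚ.+ pow p (+ h) ℚ.- pow p (+ h ℤ.- + m)
    × (∀ β → β ≢ α →
       fibreSize β ≡ pow p (+ n ℤ.- + m) ℚ.- pow p (+ h ℤ.- + m))))

  AlmostBalanced⁻ : Set
  AlmostBalanced⁻ = Bent × ∃[ h ] (n ≡ 2 ℕ.* h × ∃[ α ]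
    ( fibreSize α ≡ pow p (+ n ℤ.- + m) ℚ.- pow p (+ h) ℚ.+ pow p (+ h ℤ.- + m)
    × (∀ β → β ≢ α →
       fibreSize β ≡ pow p (+ n ℤ.- + m) ℚ.+ pow p (+ h ℤ.- + m))))

  AlmostBalanced : Set
  AlmostBalanced = AlmostBalanced⁺ ⊎ AlmostBalanced⁻

  -- The map x ↦ ⟨ b , F x ⟩, with its codomain 𝔽 p identified with 𝔽 p ^ 1.
  component : 𝔽 p ^ m → 𝔽 p ^ n → 𝔽 p ^ 1
  component b x = ⟨ b , F x ⟩ ∷ []

{-# OPTIONS --safe #-}
module Submission where

-- For a surjective linear L, translation shows that all fibres have the same
-- size, which is then p^(m-k).  Counting { x | P (G x) } fibrewise over G
-- therefore gives bentness of L ∘ F (with G the derivatives of F and P a fibre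
-- of L).  If the fibres of F have size c, except for one of size c + d, then
-- those of L ∘ F have size p^(m-k) c, except for one of size p^(m-k) c + d;
-- the types (+) and (-) are c = p^(n-m) ∓ p^(n/2-m), d = ± p^(n/2).  Components
-- are the case L = ⟨ b , _ ⟩, which is onto because nonzero residues are invertible.

open import Data.Nat.Base using (ℕ; NonZero)
open import Data.Nat.Primality using (Prime)
open import Data.Product.Base using (_×_)
open import Function.Base using (_∘_)
open import Function.Definitions using (Surjective)
open import Relation.Binary.PropositionalEquality.Core using (_≡_; _≢_)
open import Defs

open import Algebra.Bundles using (CommutativeRing; Group)
import Algebra.Module.Morphism.Structures as ModuleMorphisms
import Algebra.Properties.Group as GroupProperties
import Algebra.Properties.Ring as RingProperties
import Algebra.Properties.Semiring.Sum as Sum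
open import Algebra.Structures using (IsCommutativeRing)
open import Data.Bool.Base using (if_then_else_; true; false)
open import Data.Empty using (⊥)
open import Data.Fin.Base using (toℕ)
import Data.Fin.Properties as Fin
open import Data.Integer.Base as ℤ using (+_)
import Data.Integer.Properties as ℤ
open import Data.List.Base using (List; []; _∷_; length; filter; lookup; allFin; cartesianProductWith)
import Data.List.Base as List
import Data.List.Properties as List
open import Data.List.Membership.Propositional using (_∈_; _∉_)
open import Data.List.Membership.Propositional.Properties using (∈-allFin; ∈-cartesianProductWith⁺)
import Data.List.Relation.Unary.All as All
import Data.List.Relation.Unary.All.Properties as All
open import Data.List.Relation.Unary.AllPairs using ([]; _∷_)
open import Data.List.Relation.Unary.Any using (here; there)
open import Data.List.Relation.Unary.Unique.Propositional using (Unique)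
import Data.List.Relation.Unary.Unique.Propositional.Properties as Unique
open import Data.Nat.Base as ℕ using (zero; suc)
open import Data.Nat.Coprimality using (prime⇒coprime; coprime-Bézout)
import Data.Nat.Coprimality as Coprime
open import Data.Nat.DivMod using (_mod_; _%_; %-distribˡ-+; %-distribˡ-*; m<n⇒m%n≡m; m*n%n≡0; m%n<n)
open import Data.Nat.GCD using (module Bézout)
import Data.Nat.Properties as ℕ
open import Data.Product.Base using (_,_; ∃-syntax)
open import Data.Rational.Base as ℚ using (ℚ; 0ℚ; 1ℚ; fromℚᵘ)
import Data.Rational.Properties as ℚ
open import Data.Rational.Solver using (module +-*-Solver)
open import Data.Rational.Unnormalised.Base as ℚᵘ using (mkℚᵘ; *≡*)
import Data.Rational.Unnormalised.Properties as ℚᵘ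
import Data.Vec.Base as Vec
import Data.Vec.Properties as Vec
open import Level using (0ℓ)
open import Relation.Binary.Definitions using (DecidableEquality)
open import Relation.Binary.PropositionalEquality
  using (refl; sym; trans; cong; cong₂; isEquivalence; module ≡-Reasoning)
open import Relation.Nullary using (Dec; does; yes; no; contradiction)
open import Relation.Nullary.Decidable using (dec-true; dec-false)
open import Relation.Unary using (Pred; Decidable; _≐_)
open import Relation.Unary.Properties using (U?)

open ≡-Reasoning

-- Arithmetic modulo p

module _ {p : ℕ} .{{_ : NonZero p}} where

  toℕ-mod : ∀ a → toℕ (a mod p) ≡ a % p
  toℕ-mod a = Fin.toℕ-fromℕ< (m%n<n a p)

  mod-cong : ∀ {a b} → a % p ≡ b % p → a mod p ≡ b mod p
  mod-cong eq = Fin.fromℕ<-cong _ _ eq _ _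

  -- A residue is smaller than p, hence its own remainder. So every element of `𝔽 p` is the image of
  -- a natural number, and with `mod-homo-+` and `mod-homo-*` the ring laws are carried over from ℕ.
  toℕ-mod-inverse : (x : 𝔽 p) → toℕ x mod p ≡ x
  toℕ-mod-inverse x = Fin.toℕ-injective
    (trans (toℕ-mod (toℕ x)) (m<n⇒m%n≡m (Fin.toℕ<n x)))

  mod-homo-+ : ∀ a b → (a ℕ.+ b) mod p ≡ (a mod p) +ₚ (b mod p)
  mod-homo-+ a b = mod-cong (trans (%-distribˡ-+ a b p)
    (sym (cong₂ (λ i j → (i ℕ.+ j) % p) (toℕ-mod a) (toℕ-mod b))))

  mod-homo-* : ∀ a b → (a ℕ.* b) mod p ≡ (a mod p) *ₚ (b mod p)
  mod-homo-* a b = mod-cong (trans (%-distribˡ-* a b p)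
    (sym (cong₂ (λ i j → (i ℕ.* j) % p) (toℕ-mod a) (toℕ-mod b))))

  [a*p]mod-p≡0 : ∀ a → (a ℕ.* p) mod p ≡ 0ₚ
  [a*p]mod-p≡0 a = mod-cong (trans (m*n%n≡0 a p) (sym (m*n%n≡0 0 p)))

  1ₚ : 𝔽 p
  1ₚ = 1 mod p

  +ₚ-comm : (x y : 𝔽 p) → x +ₚ y ≡ y +ₚ x
  +ₚ-comm x y = cong (_mod p) (ℕ.+-comm (toℕ x) (toℕ y))

  *ₚ-comm : (x y : 𝔽 p) → x *ₚ y ≡ y *ₚ x
  *ₚ-comm x y = cong (_mod p) (ℕ.*-comm (toℕ x) (toℕ y))

  +ₚ-assoc : (x y z : 𝔽 p) → (x +ₚ y) +ₚ z ≡ x +ₚ (y +ₚ z)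
  +ₚ-assoc x y z = begin
    (x +ₚ y) +ₚ z                         ≡⟨ cong ((x +ₚ y) +ₚ_) (toℕ-mod-inverse z) ⟨
    (x +ₚ y) +ₚ (toℕ z mod p)             ≡⟨ mod-homo-+ (toℕ x ℕ.+ toℕ y) (toℕ z) ⟨
    (toℕ x ℕ.+ toℕ y ℕ.+ toℕ z) mod p     ≡⟨ cong (_mod p) (ℕ.+-assoc (toℕ x) (toℕ y) (toℕ z)) ⟩
    (toℕ x ℕ.+ (toℕ y ℕ.+ toℕ z)) mod p   ≡⟨ mod-homo-+ (toℕ x) (toℕ y ℕ.+ toℕ z) ⟩
    (toℕ x mod p) +ₚ (y +ₚ z)             ≡⟨ cong (_+ₚ (y +ₚ z)) (toℕ-mod-inverse x) ⟩
    x +ₚ (y +ₚ z)                         ∎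

  *ₚ-assoc : (x y z : 𝔽 p) → (x *ₚ y) *ₚ z ≡ x *ₚ (y *ₚ z)
  *ₚ-assoc x y z = begin
    (x *ₚ y) *ₚ z                         ≡⟨ cong ((x *ₚ y) *ₚ_) (toℕ-mod-inverse z) ⟨
    (x *ₚ y) *ₚ (toℕ z mod p)             ≡⟨ mod-homo-* (toℕ x ℕ.* toℕ y) (toℕ z) ⟨
    (toℕ x ℕ.* toℕ y ℕ.* toℕ z) mod p     ≡⟨ cong (_mod p) (ℕ.*-assoc (toℕ x) (toℕ y) (toℕ z)) ⟩
    (toℕ x ℕ.* (toℕ y ℕ.* toℕ z)) mod p   ≡⟨ mod-homo-* (toℕ x) (toℕ y ℕ.* toℕ z) ⟩
    (toℕ x mod p) *ₚ (y *ₚ z)             ≡⟨ cong (_*ₚ (y *ₚ z)) (toℕ-mod-inverse x) ⟩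
    x *ₚ (y *ₚ z)                         ∎

  *ₚ-distribˡ-+ₚ : (x y z : 𝔽 p) → x *ₚ (y +ₚ z) ≡ x *ₚ y +ₚ x *ₚ z
  *ₚ-distribˡ-+ₚ x y z = begin
    x *ₚ (y +ₚ z)                                   ≡⟨ cong (_*ₚ (y +ₚ z)) (toℕ-mod-inverse x) ⟨
    (toℕ x mod p) *ₚ (y +ₚ z)                       ≡⟨ mod-homo-* (toℕ x) (toℕ y ℕ.+ toℕ z) ⟨
    (toℕ x ℕ.* (toℕ y ℕ.+ toℕ z)) mod p             ≡⟨ cong (_mod p) (ℕ.*-distribˡ-+ (toℕ x) (toℕ y) (toℕ z)) ⟩
    (toℕ x ℕ.* toℕ y ℕ.+ toℕ x ℕ.* toℕ z) mod p     ≡⟨ mod-homo-+ (toℕ x ℕ.* toℕ y) (toℕ x ℕ.* toℕ z) ⟩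
    x *ₚ y +ₚ x *ₚ z                                ∎

  *ₚ-distribʳ-+ₚ : (x y z : 𝔽 p) → (y +ₚ z) *ₚ x ≡ y *ₚ x +ₚ z *ₚ x
  *ₚ-distribʳ-+ₚ x y z = begin
    (y +ₚ z) *ₚ x      ≡⟨ *ₚ-comm (y +ₚ z) x ⟩
    x *ₚ (y +ₚ z)      ≡⟨ *ₚ-distribˡ-+ₚ x y z ⟩
    x *ₚ y +ₚ x *ₚ z   ≡⟨ cong₂ _+ₚ_ (*ₚ-comm x y) (*ₚ-comm x z) ⟩
    y *ₚ x +ₚ z *ₚ x   ∎

  +ₚ-identityˡ : (x : 𝔽 p) → 0ₚ +ₚ x ≡ x
  +ₚ-identityˡ x = begin
    0ₚ +ₚ x               ≡⟨ cong (0ₚ +ₚ_) (toℕ-mod-inverse x) ⟨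
    0ₚ +ₚ (toℕ x mod p)   ≡⟨ mod-homo-+ 0 (toℕ x) ⟨
    toℕ x mod p           ≡⟨ toℕ-mod-inverse x ⟩
    x                     ∎

  *ₚ-identityˡ : (x : 𝔽 p) → 1ₚ *ₚ x ≡ x
  *ₚ-identityˡ x = begin
    1ₚ *ₚ x               ≡⟨ cong (1ₚ *ₚ_) (toℕ-mod-inverse x) ⟨
    1ₚ *ₚ (toℕ x mod p)   ≡⟨ mod-homo-* 1 (toℕ x) ⟨
    (1 ℕ.* toℕ x) mod p   ≡⟨ cong (_mod p) (ℕ.*-identityˡ (toℕ x)) ⟩
    toℕ x mod p           ≡⟨ toℕ-mod-inverse x ⟩
    x                     ∎

  -ₚ-inverseʳ : (x : 𝔽 p) → x +ₚ (-ₚ x) ≡ 0ₚ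
  -ₚ-inverseʳ x = begin
    x +ₚ (-ₚ x)                         ≡⟨ cong (_+ₚ (-ₚ x)) (toℕ-mod-inverse x) ⟨
    (toℕ x mod p) +ₚ (-ₚ x)             ≡⟨ mod-homo-+ (toℕ x) (p ℕ.∸ toℕ x) ⟨
    -- Since x < p, the truncated subtraction is an honest one and the sum is exactly p.
    (toℕ x ℕ.+ (p ℕ.∸ toℕ x)) mod p     ≡⟨ cong (_mod p) (ℕ.m+[n∸m]≡n (ℕ.<⇒≤ (Fin.toℕ<n x))) ⟩
    p mod p                             ≡⟨ cong (_mod p) (ℕ.*-identityˡ p) ⟨
    (1 ℕ.* p) mod p                     ≡⟨ [a*p]mod-p≡0 1 ⟩
    0ₚ                                  ∎

  𝔽-isCommutativeRing : IsCommutativeRing _≡_ _+ₚ_ _*ₚ_ -ₚ_ 0ₚ 1ₚ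
  𝔽-isCommutativeRing = record
    { isRing = record
      { +-isAbelianGroup = record
        { isGroup = record
          { isMonoid = record
            { isSemigroup = record
              { isMagma = record { isEquivalence = isEquivalence ; ∙-cong = cong₂ _+ₚ_ }
              ; assoc = +ₚ-assoc
              }
            ; identity = +ₚ-identityˡ , λ x → trans (+ₚ-comm x 0ₚ) (+ₚ-identityˡ x)
            }
          ; inverse = (λ x → trans (+ₚ-comm (-ₚ x) x) (-ₚ-inverseʳ x)) , -ₚ-inverseʳ
          ; ⁻¹-cong = cong -ₚ_
          }
        ; comm = +ₚ-comm
        }
      ; *-cong = cong₂ _*ₚ_
      ; *-assoc = *ₚ-assoc
      ; *-identity = *ₚ-identityˡ , λ x → trans (*ₚ-comm x 1ₚ) (*ₚ-identityˡ x)
      ; distrib = *ₚ-distribˡ-+ₚ , *ₚ-distribʳ-+ₚ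
      }
    ; *-comm = *ₚ-comm
    }

  𝔽-commutativeRing : CommutativeRing 0ℓ 0ℓ
  𝔽-commutativeRing = record { isCommutativeRing = 𝔽-isCommutativeRing }

  private
    module 𝔽 where
      open CommutativeRing 𝔽-commutativeRing public
      open RingProperties ring public

  -- Bundled so that the cancellation laws for translations and the uniqueness of the identity come
  -- from general group theory.
  +ᵥ-group : ℕ → Group 0ℓ 0ℓ
  +ᵥ-group n = record
    { Carrier = 𝔽 p ^ n
    ; _≈_ = _≡_
    ; _∙_ = _+ᵥ_
    ; ε = 0ᵥ
    ; _⁻¹ = Vec.map -ₚ_
    ; isGroup = record
      { isMonoid = record
        { isSemigroup = record
          { isMagma = record { isEquivalence = isEquivalence ; ∙-cong = cong₂ _+ᵥ_ }
          ; assoc = Vec.zipWith-assoc 𝔽.+-assoc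
          }
        ; identity = Vec.zipWith-identityˡ 𝔽.+-identityˡ , Vec.zipWith-identityʳ 𝔽.+-identityʳ
        }
      ; inverse = Vec.zipWith-inverseˡ 𝔽.-‿inverseˡ , Vec.zipWith-inverseʳ 𝔽.-‿inverseʳ
      ; ⁻¹-cong = cong (Vec.map -ₚ_)
      }
    }

  -- As 0 < `toℕ x` < p and p is prime, `toℕ x` is coprime to p; reducing a Bézout identity modulo p
  -- exhibits the inverse. The coefficients are natural numbers, so the identity comes in two
  -- orientations.
  *ₚ-inverse : Prime p → (x : 𝔽 p) → x ≢ 0ₚ → ∃[ y ] x *ₚ y ≡ 1ₚ
  *ₚ-inverse p-prime x x≢0 = case-Bézout (coprime-Bézout (Coprime.sym (prime⇒coprime p-prime (Fin.toℕ<n x))))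
    where
    instance
      toℕx≢0 : NonZero (toℕ x)
      toℕx≢0 = ℕ.≢-nonZero λ toℕx≡0 →
        x≢0 (trans (sym (toℕ-mod-inverse x)) (cong (_mod p) toℕx≡0))

    toℕx*u : ∀ u → (u ℕ.* toℕ x) mod p ≡ x *ₚ (u mod p)
    toℕx*u u = begin
      (u ℕ.* toℕ x) mod p         ≡⟨ mod-homo-* u (toℕ x) ⟩
      (u mod p) *ₚ (toℕ x mod p)  ≡⟨ cong ((u mod p) *ₚ_) (toℕ-mod-inverse x) ⟩
      (u mod p) *ₚ x              ≡⟨ *ₚ-comm (u mod p) x ⟩
      x *ₚ (u mod p)              ∎

    case-Bézout : Bézout.Identity 1 (toℕ x) p → ∃[ y ] x *ₚ y ≡ 1ₚ
    case-Bézout (Bézout.+- u v eq) = u mod p , (begin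
      x *ₚ (u mod p)             ≡⟨ toℕx*u u ⟨
      (u ℕ.* toℕ x) mod p        ≡⟨ cong (_mod p) eq ⟨
      (1 ℕ.+ v ℕ.* p) mod p      ≡⟨ mod-homo-+ 1 (v ℕ.* p) ⟩
      1ₚ +ₚ (v ℕ.* p) mod p      ≡⟨ cong (1ₚ +ₚ_) ([a*p]mod-p≡0 v) ⟩
      1ₚ +ₚ 0ₚ                   ≡⟨ 𝔽.+-identityʳ 1ₚ ⟩
      1ₚ                         ∎)
    -- Here 1 + u x = v p, so x u is -1 modulo p and the inverse is -u.
    case-Bézout (Bézout.-+ u v eq) = -ₚ (u mod p) , (begin
      x *ₚ (-ₚ (u mod p))        ≡⟨ 𝔽.-‿distribʳ-* x (u mod p) ⟨
      -ₚ (x *ₚ (u mod p))        ≡⟨ 𝔽.+-inverseˡ-unique 1ₚ (x *ₚ (u mod p)) 1+xu≡0 ⟨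
      1ₚ                         ∎)
      where
      1+xu≡0 : 1ₚ +ₚ x *ₚ (u mod p) ≡ 0ₚ
      1+xu≡0 = begin
        1ₚ +ₚ x *ₚ (u mod p)         ≡⟨ cong (1ₚ +ₚ_) (toℕx*u u) ⟨
        1ₚ +ₚ (u ℕ.* toℕ x) mod p    ≡⟨ mod-homo-+ 1 (u ℕ.* toℕ x) ⟨
        (1 ℕ.+ u ℕ.* toℕ x) mod p    ≡⟨ cong (_mod p) eq ⟩
        (v ℕ.* p) mod p              ≡⟨ [a*p]mod-p≡0 v ⟩
        0ₚ                           ∎

-- The scalar product

  ⟨⟩-+ᵥ : ∀ {m} (b u v : 𝔽 p ^ m) → ⟨ b , u +ᵥ v ⟩ ≡ ⟨ b , u ⟩ +ₚ ⟨ b , v ⟩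
  ⟨⟩-+ᵥ Vec.[] Vec.[] Vec.[] = sym (𝔽.+-identityˡ 0ₚ)
  ⟨⟩-+ᵥ (b Vec.∷ bs) (u Vec.∷ us) (v Vec.∷ vs) = begin
    b *ₚ (u +ₚ v) +ₚ ⟨ bs , us +ᵥ vs ⟩
      ≡⟨ cong₂ _+ₚ_ (𝔽.distribˡ b u v) (⟨⟩-+ᵥ bs us vs) ⟩
    (b *ₚ u +ₚ b *ₚ v) +ₚ (⟨ bs , us ⟩ +ₚ ⟨ bs , vs ⟩)
      ≡⟨ interchange (b *ₚ u) (b *ₚ v) ⟨ bs , us ⟩ ⟨ bs , vs ⟩ ⟩
    (b *ₚ u +ₚ ⟨ bs , us ⟩) +ₚ (b *ₚ v +ₚ ⟨ bs , vs ⟩)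
      ∎
    where
    open import Algebra.Properties.CommutativeSemigroup
      (CommutativeRing.+-commutativeSemigroup 𝔽-commutativeRing) using (interchange)

  ⟨⟩-*ᵥ : ∀ {m} (b : 𝔽 p ^ m) c v → ⟨ b , c *ᵥ v ⟩ ≡ c *ₚ ⟨ b , v ⟩
  ⟨⟩-*ᵥ Vec.[] c Vec.[] = sym (𝔽.zeroʳ c)
  ⟨⟩-*ᵥ (b Vec.∷ bs) c (v Vec.∷ vs) = begin
    b *ₚ (c *ₚ v) +ₚ ⟨ bs , c *ᵥ vs ⟩    ≡⟨ cong₂ _+ₚ_ (x∙yz≈y∙xz b c v) (⟨⟩-*ᵥ bs c vs) ⟩
    c *ₚ (b *ₚ v) +ₚ c *ₚ ⟨ bs , vs ⟩    ≡⟨ sym (𝔽.distribˡ c (b *ₚ v) ⟨ bs , vs ⟩) ⟩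
    c *ₚ (b *ₚ v +ₚ ⟨ bs , vs ⟩)         ∎
    where
    open import Algebra.Properties.CommutativeSemigroup
      (CommutativeRing.*-commutativeSemigroup 𝔽-commutativeRing) using (x∙yz≈y∙xz)

  -- By additivity this value equals its own double.
  ⟨⟩-0ᵥ : ∀ {m} (b : 𝔽 p ^ m) → ⟨ b , 0ᵥ ⟩ ≡ 0ₚ
  ⟨⟩-0ᵥ b = 𝔽.x+x≈x⇒x≈0 ⟨ b , 0ᵥ ⟩
    (trans (sym (⟨⟩-+ᵥ b 0ᵥ 0ᵥ)) (cong ⟨ b ,_⟩ (Group.identityˡ (+ᵥ-group _) 0ᵥ)))

  ⟨⟩--ᵥ : ∀ {m} (b v : 𝔽 p ^ m) → ⟨ b , Vec.map -ₚ_ v ⟩ ≡ -ₚ ⟨ b , v ⟩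
  ⟨⟩--ᵥ b v = 𝔽.+-inverseʳ-unique ⟨ b , v ⟩ ⟨ b , Vec.map -ₚ_ v ⟩ (begin
    ⟨ b , v ⟩ +ₚ ⟨ b , Vec.map -ₚ_ v ⟩   ≡⟨ sym (⟨⟩-+ᵥ b v (Vec.map -ₚ_ v)) ⟩
    ⟨ b , v -ᵥ v ⟩                       ≡⟨ cong ⟨ b ,_⟩ (Group.inverseʳ (+ᵥ-group _) v) ⟩
    ⟨ b , 0ᵥ ⟩                           ≡⟨ ⟨⟩-0ᵥ b ⟩
    0ₚ                                   ∎)

  -- The values are vectors with one entry, so that this is an instance of a linear map L with k =
  -- 1.
  functional : ∀ {m} → 𝔽 p ^ m → 𝔽 p ^ m → 𝔽 p ^ 1
  functional b v = ⟨ b , v ⟩ Vec.∷ Vec.[]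

  functional-isLinear : ∀ {m} (b : 𝔽 p ^ m) → IsLinear (functional b)
  functional-isLinear b = record
    { +ᴹ-isGroupHomomorphism = record
      { isMonoidHomomorphism = record
        { isMagmaHomomorphism = record
          { isRelHomomorphism = record { cong = cong (functional b) }
          ; homo = λ u v → cong (Vec._∷ Vec.[]) (⟨⟩-+ᵥ b u v)
          }
        ; ε-homo = cong (Vec._∷ Vec.[]) (⟨⟩-0ᵥ b)
        }
      ; ⁻¹-homo = λ v → cong (Vec._∷ Vec.[]) (⟨⟩--ᵥ b v)
      }
    ; *ₗ-homo = λ c v → cong (Vec._∷ Vec.[]) (⟨⟩-*ᵥ b c v)
    }

  -- The recursion looks for the first nonzero coordinate of b. The vector v has c divided by that
  -- coordinate in its place and zeros elsewhere. Running out of coordinates would mean that b is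
  -- zero.
  ⟨⟩-surjective : Prime p → ∀ {m} (b : 𝔽 p ^ m) → b ≢ 0ᵥ → ∀ c → ∃[ v ] ⟨ b , v ⟩ ≡ c
  ⟨⟩-surjective p-prime Vec.[] b≢0 c = contradiction refl b≢0
  ⟨⟩-surjective p-prime (b Vec.∷ bs) b≢0 c with b Fin.≟ 0ₚ
  ... | yes refl =
    let v , eq = ⟨⟩-surjective p-prime bs (b≢0 ∘ cong (0ₚ Vec.∷_)) c
    in 0ₚ Vec.∷ v , (begin
      0ₚ *ₚ 0ₚ +ₚ ⟨ bs , v ⟩   ≡⟨ cong (_+ₚ ⟨ bs , v ⟩) (𝔽.zeroˡ 0ₚ) ⟩
      0ₚ +ₚ ⟨ bs , v ⟩         ≡⟨ 𝔽.+-identityˡ ⟨ bs , v ⟩ ⟩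
      ⟨ bs , v ⟩               ≡⟨ eq ⟩
      c                        ∎)
  ... | no b≢0ₚ =
    let b⁻¹ , eq = *ₚ-inverse p-prime b b≢0ₚ
    in (b⁻¹ *ₚ c) Vec.∷ 0ᵥ , (begin
      b *ₚ (b⁻¹ *ₚ c) +ₚ ⟨ bs , 0ᵥ ⟩   ≡⟨ cong (b *ₚ (b⁻¹ *ₚ c) +ₚ_) (⟨⟩-0ᵥ bs) ⟩
      b *ₚ (b⁻¹ *ₚ c) +ₚ 0ₚ            ≡⟨ 𝔽.+-identityʳ _ ⟩
      b *ₚ (b⁻¹ *ₚ c)                  ≡⟨ 𝔽.*-assoc b b⁻¹ c ⟨
      (b *ₚ b⁻¹) *ₚ c                  ≡⟨ cong (_*ₚ c) eq ⟩
      1ₚ *ₚ c                          ≡⟨ 𝔽.*-identityˡ c ⟩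
      c                                ∎)

  functional-surjective : Prime p → ∀ {m} (b : 𝔽 p ^ m) → b ≢ 0ᵥ → Surjective _≡_ _≡_ (functional b)
  functional-surjective p-prime b b≢0 (c Vec.∷ Vec.[]) =
    let v , eq = ⟨⟩-surjective p-prime b b≢0 c
    in v , λ { refl → cong (Vec._∷ Vec.[]) eq }


-- Powers of p

-- Operations on ℚ normalise by a gcd, which is stuck on open terms. On unnormalised fractions
-- equality is cross-multiplication, so identities are checked there and brought back by `fromℚᵘ`.
fromℚᵘ-homo-+ : ∀ x y → fromℚᵘ (x ℚᵘ.+ y) ≡ fromℚᵘ x ℚ.+ fromℚᵘ y
fromℚᵘ-homo-+ x y = ℚ.toℚᵘ-injective
  (ℚᵘ.≃-trans (ℚ.toℚᵘ-fromℚᵘ (x ℚᵘ.+ y)) (ℚᵘ.≃-sym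
  (ℚᵘ.≃-trans (ℚ.toℚᵘ-homo-+ (fromℚᵘ x) (fromℚᵘ y))
              (ℚᵘ.+-cong (ℚ.toℚᵘ-fromℚᵘ x) (ℚ.toℚᵘ-fromℚᵘ y)))))

fromℚᵘ-homo-* : ∀ x y → fromℚᵘ (x ℚᵘ.* y) ≡ fromℚᵘ x ℚ.* fromℚᵘ y
fromℚᵘ-homo-* x y = ℚ.toℚᵘ-injective
  (ℚᵘ.≃-trans (ℚ.toℚᵘ-fromℚᵘ (x ℚᵘ.* y)) (ℚᵘ.≃-sym
  (ℚᵘ.≃-trans (ℚ.toℚᵘ-homo-* (fromℚᵘ x) (fromℚᵘ y))
              (ℚᵘ.*-cong (ℚ.toℚᵘ-fromℚᵘ x) (ℚ.toℚᵘ-fromℚᵘ y)))))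

-- Counts and the powers `pow p (+ e)` are definitionally values of this function, and each value is
-- `fromℚᵘ` of a fraction with denominator 1.
fromℕ : ℕ → ℚ
fromℕ n = + n ℚ./ 1

fromℕ-suc : ∀ n → fromℕ (suc n) ≡ 1ℚ ℚ.+ fromℕ n
fromℕ-suc n = trans
  (ℚ.fromℚᵘ-cong {mkℚᵘ (+ suc n) 0} {mkℚᵘ (+ 1) 0 ℚᵘ.+ mkℚᵘ (+ n) 0}
    (*≡* (cong (λ i → (+ 1 ℤ.+ i) ℤ.* + 1) (sym (ℤ.*-identityʳ (+ n))))))
  (fromℚᵘ-homo-+ (mkℚᵘ (+ 1) 0) (mkℚᵘ (+ n) 0))

fromℕ-homo-* : ∀ m n → fromℕ (m ℕ.* n) ≡ fromℕ m ℚ.* fromℕ n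
fromℕ-homo-* m n = trans
  (ℚ.fromℚᵘ-cong {mkℚᵘ (+ (m ℕ.* n)) 0} {mkℚᵘ (+ m) 0 ℚᵘ.* mkℚᵘ (+ n) 0}
    (*≡* (cong (ℤ._* + 1) (ℤ.pos-* m n))))
  (fromℚᵘ-homo-* (mkℚᵘ (+ m) 0) (mkℚᵘ (+ n) 0))

1/n*n≡1 : ∀ n .{{_ : NonZero n}} → (+ 1 ℚ./ n) ℚ.* fromℕ n ≡ 1ℚ
1/n*n≡1 n@(suc n-1) = trans
  (sym (fromℚᵘ-homo-* (mkℚᵘ (+ 1) n-1) (mkℚᵘ (+ n) 0)))
  (ℚ.fromℚᵘ-cong {mkℚᵘ (+ 1) n-1 ℚᵘ.* mkℚᵘ (+ n) 0} {mkℚᵘ (+ 1) 0}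
    (*≡* (cong +_ (trans (ℕ.*-identityʳ (1 ℕ.* n)) (cong (1 ℕ.*_) (sym (ℕ.*-identityʳ n)))))))

module _ (p : ℕ) .{{_ : NonZero p}} where

  pow-suc : ∀ e → pow p (+ suc e) ≡ fromℕ p ℚ.* pow p (+ e)
  pow-suc e = fromℕ-homo-* p (p ℕ.^ e)

  -- The power has a reciprocal in ℚ. This allows negative exponents to be cleared by multiplying
  -- both sides of an identity by a large enough power of p.
  pow-*-cancelʳ : ∀ e {x y} → x ℚ.* pow p (+ e) ≡ y ℚ.* pow p (+ e) → x ≡ y
  pow-*-cancelʳ e {x} {y} eq = begin
    x                        ≡⟨ x*r*r⁻¹≡x x ⟨
    x ℚ.* r ℚ.* r⁻¹          ≡⟨ cong (ℚ._* r⁻¹) eq ⟩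
    y ℚ.* r ℚ.* r⁻¹          ≡⟨ x*r*r⁻¹≡x y ⟩
    y                        ∎
    where
    instance
      p^e≢0 : NonZero (p ℕ.^ e)
      p^e≢0 = ℕ.m^n≢0 p e

    r r⁻¹ : ℚ
    r = pow p (+ e)
    r⁻¹ = + 1 ℚ./ (p ℕ.^ e)

    x*r*r⁻¹≡x : ∀ x → x ℚ.* r ℚ.* r⁻¹ ≡ x
    x*r*r⁻¹≡x x = begin
      x ℚ.* r ℚ.* r⁻¹     ≡⟨ ℚ.*-assoc x r r⁻¹ ⟩
      x ℚ.* (r ℚ.* r⁻¹)   ≡⟨ cong (x ℚ.*_) (ℚ.*-comm r r⁻¹) ⟩
      x ℚ.* (r⁻¹ ℚ.* r)   ≡⟨ cong (x ℚ.*_) (1/n*n≡1 (p ℕ.^ e)) ⟩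
      x ℚ.* 1ℚ            ≡⟨ ℚ.*-identityʳ x ⟩
      x                   ∎

  -- On open terms `pow` cannot see the sign of a difference. Peeling off common successors ends
  -- with a or b equal to zero, where the sign is known; each round takes one factor p out of both
  -- sides.
  pow-⊖-* : ∀ a b → pow p (a ℤ.⊖ b) ℚ.* pow p (+ b) ≡ pow p (+ a)
  pow-⊖-* a zero = ℚ.*-identityʳ (pow p (+ a))
  pow-⊖-* zero (suc b) = 1/n*n≡1 (p ℕ.^ suc b) {{ℕ.m^n≢0 p (suc b)}}
  pow-⊖-* (suc a) (suc b) = begin
    pow p (suc a ℤ.⊖ suc b) ℚ.* pow p (+ suc b)
      ≡⟨ cong₂ (λ i q → pow p i ℚ.* q) (ℤ.[1+m]⊖[1+n]≡m⊖n a b) (pow-suc b) ⟩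
    pow p (a ℤ.⊖ b) ℚ.* (fromℕ p ℚ.* pow p (+ b))
      ≡⟨ solve 3 (λ x y z → x :* (y :* z) := y :* (x :* z)) refl
           (pow p (a ℤ.⊖ b)) (fromℕ p) (pow p (+ b)) ⟩
    fromℕ p ℚ.* (pow p (a ℤ.⊖ b) ℚ.* pow p (+ b))
      ≡⟨ cong (fromℕ p ℚ.*_) (pow-⊖-* a b) ⟩
    fromℕ p ℚ.* pow p (+ a)
      ≡⟨ pow-suc a ⟨
    pow p (+ suc a)
      ∎
    where open +-*-Solver

  pow-minus-* : ∀ a b → pow p (+ a ℤ.- + b) ℚ.* pow p (+ b) ≡ pow p (+ a)
  pow-minus-* a b = trans
    (cong (λ i → pow p i ℚ.* pow p (+ b)) (ℤ.m-n≡m⊖n a b)) (pow-⊖-* a b)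

  -- After multiplication by p^c the left side collapses from the right, first to p^b and then to
  -- p^a, and the right side becomes p^a as well.
  pow-telescope : ∀ a b c →
    pow p (+ a ℤ.- + b) ℚ.* pow p (+ b ℤ.- + c) ≡ pow p (+ a ℤ.- + c)
  pow-telescope a b c = pow-*-cancelʳ c (begin
    pow p (+ a ℤ.- + b) ℚ.* pow p (+ b ℤ.- + c) ℚ.* pow p (+ c)
      ≡⟨ ℚ.*-assoc (pow p (+ a ℤ.- + b)) (pow p (+ b ℤ.- + c)) (pow p (+ c)) ⟩
    pow p (+ a ℤ.- + b) ℚ.* (pow p (+ b ℤ.- + c) ℚ.* pow p (+ c))
      ≡⟨ cong (pow p (+ a ℤ.- + b) ℚ.*_) (pow-minus-* b c) ⟩
    pow p (+ a ℤ.- + b) ℚ.* pow p (+ b)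
      ≡⟨ pow-minus-* a b ⟩
    pow p (+ a)
      ≡⟨ pow-minus-* a c ⟨
    pow p (+ a ℤ.- + c) ℚ.* pow p (+ c)
      ∎)

-- Counting

open Sum (CommutativeRing.semiring ℚ.+-*-commutativeRing)
  using (sum; sum-cong-≗; ∑-comm; ∑-distrib-+; *-distribˡ-sum)

-- The Iverson bracket. It inspects only `does`, so that one case split on `does` evaluates it
-- together with `filter`.
𝟙 : {A : Set} → Dec A → ℚ
𝟙 a? = if does a? then 1ℚ else 0ℚ

𝟙-true : {A : Set} (a? : Dec A) → A → 𝟙 a? ≡ 1ℚ
𝟙-true a? a = cong (if_then 1ℚ else 0ℚ) (dec-true a? a)

𝟙-false : {A : Set} (a? : Dec A) → (A → ⊥) → 𝟙 a? ≡ 0ℚ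
𝟙-false a? ¬a = cong (if_then 1ℚ else 0ℚ) (dec-false a? ¬a)

-- Indexing by positions makes this a finite sum over `Fin (length xs)`, to which the semiring laws
-- for interchanging and scaling sums apply.
∑ : {A : Set} → List A → (A → ℚ) → ℚ
∑ xs f = sum (f ∘ lookup xs)

∑-cong : {A : Set} (xs : List A) {f g : A → ℚ} → (∀ x → f x ≡ g x) → ∑ xs f ≡ ∑ xs g
∑-cong xs f≗g = sum-cong-≗ (f≗g ∘ lookup xs)

fromℕ-length-filter : {A : Set} {P : Pred A 0ℓ} (P? : Decidable P) (xs : List A) →
  fromℕ (length (filter P? xs)) ≡ ∑ xs (𝟙 ∘ P?)
fromℕ-length-filter P? [] = refl
fromℕ-length-filter P? (x ∷ xs) with does (P? x)
... | true = trans (fromℕ-suc (length (filter P? xs))) (cong (1ℚ ℚ.+_) (fromℕ-length-filter P? xs))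
... | false = trans (fromℕ-length-filter P? xs) (sym (ℚ.+-identityˡ _))

module _ {A : Set} (_≟′_ : DecidableEquality A) (f : A → ℚ) (z : A) where

  ∑-δ-∉ : ∀ xs → z ∉ xs → ∑ xs (λ y → f y ℚ.* 𝟙 (z ≟′ y)) ≡ 0ℚ
  ∑-δ-∉ [] z∉xs = refl
  ∑-δ-∉ (x ∷ xs) z∉xs = begin
    f x ℚ.* 𝟙 (z ≟′ x) ℚ.+ ∑ xs (λ y → f y ℚ.* 𝟙 (z ≟′ y))
      ≡⟨ cong₂ (λ u v → f x ℚ.* u ℚ.+ v) (𝟙-false (z ≟′ x) (z∉xs ∘ here)) (∑-δ-∉ xs (z∉xs ∘ there)) ⟩
    f x ℚ.* 0ℚ ℚ.+ 0ℚ
      ≡⟨ cong (ℚ._+ 0ℚ) (ℚ.*-zeroʳ (f x)) ⟩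
    0ℚ
      ∎

  -- The sifting property of the Kronecker delta: without repetitions z sits at a single position,
  -- and all other terms vanish.
  ∑-δ : ∀ {xs} → Unique xs → z ∈ xs → ∑ xs (λ y → f y ℚ.* 𝟙 (z ≟′ y)) ≡ f z
  ∑-δ {x ∷ xs} (x∉xs ∷ _) (here refl) = begin
    f z ℚ.* 𝟙 (z ≟′ z) ℚ.+ ∑ xs (λ y → f y ℚ.* 𝟙 (z ≟′ y))
      ≡⟨ cong₂ (λ u v → f z ℚ.* u ℚ.+ v) (𝟙-true (z ≟′ z) refl) (∑-δ-∉ xs (All.All¬⇒¬Any x∉xs)) ⟩
    f z ℚ.* 1ℚ ℚ.+ 0ℚ
      ≡⟨ trans (ℚ.+-identityʳ _) (ℚ.*-identityʳ (f z)) ⟩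
    f z
      ∎
  ∑-δ {x ∷ xs} (x∉xs ∷ xs!) (there z∈xs) = begin
    f x ℚ.* 𝟙 (z ≟′ x) ℚ.+ ∑ xs (λ y → f y ℚ.* 𝟙 (z ≟′ y))
      ≡⟨ cong₂ (λ u v → f x ℚ.* u ℚ.+ v)
           (𝟙-false (z ≟′ x) (λ z≡x → All.lookup x∉xs z∈xs (sym z≡x))) (∑-δ xs! z∈xs) ⟩
    f x ℚ.* 0ℚ ℚ.+ f z
      ≡⟨ cong (ℚ._+ f z) (ℚ.*-zeroʳ (f x)) ⟩
    0ℚ ℚ.+ f z
      ≡⟨ ℚ.+-identityˡ (f z) ⟩
    f z
      ∎

-- Enumerating and counting vectors

module _ {p : ℕ} where

  allVectors-unique : ∀ n → Unique (allVectors p n)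
  allVectors-unique zero = All.[] ∷ []
  allVectors-unique (suc n) =
    Unique.cartesianProductWith⁺ Vec._∷_ Vec.∷-injective (Unique.allFin⁺ p) (allVectors-unique n)

  ∈-allVectors : ∀ {n} (v : 𝔽 p ^ n) → v ∈ allVectors p n
  ∈-allVectors Vec.[] = here refl
  ∈-allVectors (x Vec.∷ v) = ∈-cartesianProductWith⁺ Vec._∷_ (∈-allFin x) (∈-allVectors v)

  length-allVectors : ∀ n → length (allVectors p n) ≡ p ℕ.^ n
  length-allVectors zero = refl
  length-allVectors (suc n) = trans (length-cartesianProductWith (allFin p))
    (cong₂ ℕ._*_ (List.length-tabulate {n = p} (λ i → i)) (length-allVectors n))
    where
    length-cartesianProductWith : ∀ xs →
      length (cartesianProductWith Vec._∷_ xs (allVectors p n)) ≡ length xs ℕ.* length (allVectors p n)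
    length-cartesianProductWith [] = refl
    length-cartesianProductWith (x ∷ xs) =
      trans (List.length-++ (List.map (x Vec.∷_) (allVectors p n)))
        (cong₂ ℕ._+_ (List.length-map (x Vec.∷_) (allVectors p n)) (length-cartesianProductWith xs))

  #-∑ : ∀ {n} {P : Pred (𝔽 p ^ n) 0ℓ} (P? : Decidable P) → # P? ≡ ∑ (allVectors p n) (𝟙 ∘ P?)
  #-∑ P? = fromℕ-length-filter P? (allVectors p _)

  #-cong : ∀ {n} {P Q : Pred (𝔽 p ^ n) 0ℓ} (P? : Decidable P) (Q? : Decidable Q) →
    P ≐ Q → # P? ≡ # Q?
  #-cong P? Q? P≐Q = cong (fromℕ ∘ length) (List.filter-≐ P? Q? P≐Q (allVectors p _))

  #-≡ : ∀ {n} (z : 𝔽 p ^ n) → # (λ y → z ≟ y) ≡ 1ℚ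
  #-≡ {n} z = begin
    # (λ y → z ≟ y)                                ≡⟨ #-∑ (λ y → z ≟ y) ⟩
    ∑ (allVectors p n) (λ y → 𝟙 (z ≟ y))           ≡⟨ ∑-cong (allVectors p n) (λ y → sym (ℚ.*-identityˡ (𝟙 (z ≟ y)))) ⟩
    ∑ (allVectors p n) (λ y → 1ℚ ℚ.* 𝟙 (z ≟ y))    ≡⟨ ∑-δ _≟_ (λ _ → 1ℚ) z (allVectors-unique n) (∈-allVectors z) ⟩
    1ℚ                                             ∎

  module _ .{{_ : NonZero p}} where

    #-U : ∀ n → # (U? {A = 𝔽 p ^ n}) ≡ pow p (+ n)
    #-U n = cong fromℕ (trans
      (cong length (List.filter-all U? {allVectors p n} (All.universal (λ _ → _) _)))
      (length-allVectors n))

    -- Counting along the fibres of a map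

    module _ {n m} (G : 𝔽 p ^ n → 𝔽 p ^ m) {P : Pred (𝔽 p ^ m) 0ℓ} (P? : Decidable P) where

      #-∘ : # (P? ∘ G) ≡ ∑ (allVectors p m) (λ y → 𝟙 (P? y) ℚ.* fibreSize G y)
      #-∘ = begin
        # (P? ∘ G)
          ≡⟨ #-∑ (P? ∘ G) ⟩
        ∑ X (λ x → 𝟙 (P? (G x)))
          -- Double counting of the pairs (x, y) with G x = y: a delta spreads each term over all y,
          -- and once the sums are interchanged the inner sum over x is a fibre size.
          ≡⟨ ∑-cong X (λ x → sym (∑-δ _≟_ (𝟙 ∘ P?) (G x) (allVectors-unique m) (∈-allVectors (G x)))) ⟩
        ∑ X (λ x → ∑ Y (λ y → 𝟙 (P? y) ℚ.* 𝟙 (G x ≟ y)))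
          ≡⟨ ∑-comm (λ i j → 𝟙 (P? (lookup Y j)) ℚ.* 𝟙 (G (lookup X i) ≟ lookup Y j)) ⟩
        ∑ Y (λ y → ∑ X (λ x → 𝟙 (P? y) ℚ.* 𝟙 (G x ≟ y)))
          ≡⟨ ∑-cong Y (λ y → begin
               ∑ X (λ x → 𝟙 (P? y) ℚ.* 𝟙 (G x ≟ y))
                 ≡⟨ *-distribˡ-sum (𝟙 (P? y)) (λ i → 𝟙 (G (lookup X i) ≟ y)) ⟨
               𝟙 (P? y) ℚ.* ∑ X (λ x → 𝟙 (G x ≟ y))
                 ≡⟨ cong (𝟙 (P? y) ℚ.*_) (#-∑ (λ x → G x ≟ y)) ⟨
               𝟙 (P? y) ℚ.* fibreSize G y
                 ∎) ⟩
        ∑ Y (λ y → 𝟙 (P? y) ℚ.* fibreSize G y)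
          ∎
        where
        X = allVectors p n
        Y = allVectors p m

      #-∘-almostUniform : ∀ {c d} α →
        fibreSize G α ≡ c ℚ.+ d → (∀ y → y ≢ α → fibreSize G y ≡ c) →
        # (P? ∘ G) ≡ # P? ℚ.* c ℚ.+ 𝟙 (P? α) ℚ.* d
      #-∘-almostUniform {c} {d} α fibre-α fibre-y = begin
        # (P? ∘ G)
          ≡⟨ #-∘ ⟩
        ∑ Y (λ y → 𝟙 (P? y) ℚ.* fibreSize G y)
          ≡⟨ ∑-cong Y expand ⟩
        ∑ Y (λ y → c ℚ.* 𝟙 (P? y) ℚ.+ 𝟙 (P? y) ℚ.* d ℚ.* 𝟙 (α ≟ y))
          ≡⟨ ∑-distrib-+ (λ j → c ℚ.* 𝟙 (P? (lookup Y j))) _ ⟩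
        ∑ Y (λ y → c ℚ.* 𝟙 (P? y)) ℚ.+ ∑ Y (λ y → 𝟙 (P? y) ℚ.* d ℚ.* 𝟙 (α ≟ y))
          ≡⟨ cong₂ ℚ._+_
               (sym (*-distribˡ-sum c (λ j → 𝟙 (P? (lookup Y j)))))
               (∑-δ _≟_ (λ y → 𝟙 (P? y) ℚ.* d) α (allVectors-unique m) (∈-allVectors α)) ⟩
        c ℚ.* ∑ Y (λ y → 𝟙 (P? y)) ℚ.+ 𝟙 (P? α) ℚ.* d
          ≡⟨ cong (λ s → c ℚ.* s ℚ.+ 𝟙 (P? α) ℚ.* d) (#-∑ P?) ⟨
        c ℚ.* # P? ℚ.+ 𝟙 (P? α) ℚ.* d
          ≡⟨ cong (ℚ._+ 𝟙 (P? α) ℚ.* d) (ℚ.*-comm c (# P?)) ⟩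
        # P? ℚ.* c ℚ.+ 𝟙 (P? α) ℚ.* d
          ∎
        where
        open +-*-Solver
        Y = allVectors p m

        -- One formula for both kinds of fibre: the common size c, plus an excess d carried by a
        -- delta at α. In the sum `∑-δ` then keeps d exactly when P holds at α.
        expand : ∀ y → 𝟙 (P? y) ℚ.* fibreSize G y ≡
                       c ℚ.* 𝟙 (P? y) ℚ.+ 𝟙 (P? y) ℚ.* d ℚ.* 𝟙 (α ≟ y)
        expand y with α ≟ y
        -- The case split has evaluated the delta, which the solver sees as the constant `1ℚ` here
        -- and `0ℚ` in the other case.
        ... | yes refl = trans (cong (𝟙 (P? y) ℚ.*_) fibre-α)
          (solve 3 (λ i c d → i :* (c :+ d) := c :* i :+ i :* d :* con 1ℚ) refl (𝟙 (P? y)) c d)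
        ... | no α≢y = trans (cong (𝟙 (P? y) ℚ.*_) (fibre-y y (α≢y ∘ sym)))
          (solve 3 (λ i c d → i :* c := c :* i :+ i :* d :* con 0ℚ) refl (𝟙 (P? y)) c d)

      #-∘-uniform : ∀ {c} → (∀ y → fibreSize G y ≡ c) → # (P? ∘ G) ≡ # P? ℚ.* c
      #-∘-uniform {c} fibre-y = begin
        -- The case of excess zero, where any point may serve as the exceptional one; `0ᵥ` is at
        -- hand.
        # (P? ∘ G)                              ≡⟨ #-∘-almostUniform 0ᵥ (trans (fibre-y 0ᵥ) (sym (ℚ.+-identityʳ c))) (λ y _ → fibre-y y) ⟩
        # P? ℚ.* c ℚ.+ 𝟙 (P? 0ᵥ) ℚ.* 0ℚ         ≡⟨ cong (# P? ℚ.* c ℚ.+_) (ℚ.*-zeroʳ (𝟙 (P? 0ᵥ))) ⟩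
        # P? ℚ.* c ℚ.+ 0ℚ                       ≡⟨ ℚ.+-identityʳ (# P? ℚ.* c) ⟩
        # P? ℚ.* c                              ∎

    #-∘-+ᵥ : ∀ {m} (t : 𝔽 p ^ m) {P : Pred (𝔽 p ^ m) 0ℓ} (P? : Decidable P) →
      # (λ x → P? (x +ᵥ t)) ≡ # P?
    #-∘-+ᵥ t P? = trans (#-∘-uniform (_+ᵥ t) P? fibre) (ℚ.*-identityʳ (# P?))
      where
      open GroupProperties (+ᵥ-group _) using (//-rightDividesˡ; //-rightDividesʳ)

      -- The only preimage of y is `y -ᵥ t`.
      fibre : ∀ y → fibreSize (_+ᵥ t) y ≡ 1ℚ
      fibre y = trans
        (#-cong (λ x → x +ᵥ t ≟ y) (λ x → y -ᵥ t ≟ x)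
          ( (λ { refl → //-rightDividesʳ t _ })
          , (λ { refl → //-rightDividesˡ t y })))
        (#-≡ (y -ᵥ t))

    -- Fibres of surjective linear maps

    module _ {m k} (L : 𝔽 p ^ m → 𝔽 p ^ k) (L-linear : IsLinear L) (L-surjective : Surjective _≡_ _≡_ L) where

      open ModuleMorphisms.LeftModuleMorphisms.IsLeftModuleHomomorphism L-linear
        using (+ᴹ-homo; -ᴹ-homo)

      homo--ᵥ : ∀ u v → L (u -ᵥ v) ≡ L u -ᵥ L v
      homo--ᵥ u v = trans (+ᴹ-homo u (Vec.map -ₚ_ v)) (cong (L u +ᵥ_) (-ᴹ-homo v))

      -- If L t = β, then translation by t carries the kernel of L onto the fibre over β.
      fibreSize-linear-constant : ∀ β → fibreSize L β ≡ fibreSize L 0ᵥ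
      fibreSize-linear-constant β = let t , Lt≡β = L-surjective β in begin
        # (λ x → L x ≟ β)          ≡⟨ #-∘-+ᵥ t (λ x → L x ≟ β) ⟨
        # (λ x → L (x +ᵥ t) ≟ β)   ≡⟨ #-cong (λ x → L (x +ᵥ t) ≟ β) (λ x → L x ≟ 0ᵥ)
          ( (λ {x} eq → identityˡ-unique (L x) β (trans (sym (shift t (Lt≡β refl) x)) eq))
          , (λ {x} eq → trans (shift t (Lt≡β refl) x)
              (trans (cong (_+ᵥ β) eq) (Group.identityˡ (+ᵥ-group k) β)))) ⟩
        # (λ x → L x ≟ 0ᵥ)         ∎
        where
        open GroupProperties (+ᵥ-group k) using (identityˡ-unique)

        shift : ∀ t → L t ≡ β → ∀ x → L (x +ᵥ t) ≡ L x +ᵥ β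
        shift t Lt≡β x = trans (+ᴹ-homo x t) (cong (L x +ᵥ_) Lt≡β)

      -- The domain with its p^m vectors is partitioned into p^k fibres of equal size; the factor
      -- p^k is then cancelled.
      fibreSize-linear : ∀ β → fibreSize L β ≡ pow p (+ m ℤ.- + k)
      fibreSize-linear β = trans (fibreSize-linear-constant β) (pow-*-cancelʳ p k (begin
        fibreSize L 0ᵥ ℚ.* pow p (+ k)          ≡⟨ ℚ.*-comm _ (pow p (+ k)) ⟩
        pow p (+ k) ℚ.* fibreSize L 0ᵥ          ≡⟨ cong (ℚ._* fibreSize L 0ᵥ) (#-U k) ⟨
        -- The always true predicate pulls back along L to the always true predicate, so fibrewise
        -- counting yields the size of the whole domain.
        # (U? {A = 𝔽 p ^ k}) ℚ.* fibreSize L 0ᵥ ≡⟨ #-∘-uniform L U? fibreSize-linear-constant ⟨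
        # (U? {A = 𝔽 p ^ m})                    ≡⟨ #-U m ⟩
        pow p (+ m)                             ≡⟨ pow-minus-* p m k ⟨
        pow p (+ m ℤ.- + k) ℚ.* pow p (+ k)     ∎))

      -- Composing F with a surjective linear map

      module _ {n} (F : 𝔽 p ^ n → 𝔽 p ^ m) where

        -- The derivative of `L ∘ F` in direction a is L applied to that of F. By bentness the
        -- latter has all fibres of size p^(n-m), and the fibre of L over b has p^(m-k) points.
        bent-∘ : Bent F → Bent (L ∘ F)
        bent-∘ F-bent a a≢0 b = begin
          # (λ x → L (F (x +ᵥ a)) -ᵥ L (F x) ≟ b)
            ≡⟨ #-cong _ (λ x → L (F (x +ᵥ a) -ᵥ F x) ≟ b)
                 ( (λ {x} eq → trans (homo--ᵥ (F (x +ᵥ a)) (F x)) eq)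
                 , (λ {x} eq → trans (sym (homo--ᵥ (F (x +ᵥ a)) (F x))) eq)) ⟩
          # (λ x → L (F (x +ᵥ a) -ᵥ F x) ≟ b)
            ≡⟨ #-∘-uniform (λ x → F (x +ᵥ a) -ᵥ F x) (λ y → L y ≟ b) (F-bent a a≢0) ⟩
          fibreSize L b ℚ.* pow p (+ n ℤ.- + m)
            ≡⟨ cong (ℚ._* pow p (+ n ℤ.- + m)) (fibreSize-linear b) ⟩
          pow p (+ m ℤ.- + k) ℚ.* pow p (+ n ℤ.- + m)
            ≡⟨ trans (ℚ.*-comm (pow p (+ m ℤ.- + k)) _) (pow-telescope p n m k) ⟩
          pow p (+ n ℤ.- + k)
            ∎

        module _ {c d α} (fibre-α : fibreSize F α ≡ c ℚ.+ d) (fibre-β : ∀ β → β ≢ α → fibreSize F β ≡ c) where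

          -- Each of the p^(m-k) points of the fibre of L over β contributes c, and α adds its
          -- excess d if it lies in that fibre. So `L α` becomes the exceptional value.
          fibreSize-∘ : ∀ β → fibreSize (L ∘ F) β ≡ pow p (+ m ℤ.- + k) ℚ.* c ℚ.+ 𝟙 (L α ≟ β) ℚ.* d
          fibreSize-∘ β = trans
            (#-∘-almostUniform F (λ y → L y ≟ β) α fibre-α fibre-β)
            (cong (λ s → s ℚ.* c ℚ.+ 𝟙 (L α ≟ β) ℚ.* d) (fibreSize-linear β))

          fibreSize-∘-at : fibreSize (L ∘ F) (L α) ≡ pow p (+ m ℤ.- + k) ℚ.* c ℚ.+ d
          fibreSize-∘-at = trans (fibreSize-∘ (L α)) (cong (pow p (+ m ℤ.- + k) ℚ.* c ℚ.+_)
            (trans (cong (ℚ._* d) (𝟙-true (L α ≟ L α) refl)) (ℚ.*-identityˡ d)))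

          fibreSize-∘-off : ∀ β → β ≢ L α → fibreSize (L ∘ F) β ≡ pow p (+ m ℤ.- + k) ℚ.* c
          fibreSize-∘-off β β≢Lα = trans (fibreSize-∘ β)
            (trans (cong (pow p (+ m ℤ.- + k) ℚ.* c ℚ.+_)
              (trans (cong (ℚ._* d) (𝟙-false (L α ≟ β) (β≢Lα ∘ sym))) (ℚ.*-zeroˡ d)))
              (ℚ.+-identityʳ _))

        -- Applied with a = n and a = h: the fibre size of L replaces m by k in both powers that
        -- make up c, while the excess, plus or minus p^h, stays unscaled.
        rescale : ∀ a → pow p (+ m ℤ.- + k) ℚ.* pow p (+ a ℤ.- + m) ≡ pow p (+ a ℤ.- + k)
        rescale a = trans (ℚ.*-comm (pow p (+ m ℤ.- + k)) (pow p (+ a ℤ.- + m))) (pow-telescope p a m k)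

        almostBalanced⁺-∘ : AlmostBalanced⁺ F → AlmostBalanced⁺ (L ∘ F)
        almostBalanced⁺-∘ (F-bent , h , n≡2h , α , at-α , off-α) =
          bent-∘ F-bent , h , n≡2h , L α ,
          (begin
            fibreSize (L ∘ F) (L α)                      ≡⟨ fibreSize-∘-at at-α′ off-α ⟩
            q ℚ.* (a ℚ.- b) ℚ.+ d                        ≡⟨ solve 4 (λ q a b d → q :* (a :- b) :+ d := q :* a :+ d :- q :* b) refl q a b d ⟩
            q ℚ.* a ℚ.+ d ℚ.- q ℚ.* b                    ≡⟨ cong₂ (λ x y → x ℚ.+ d ℚ.- y) (rescale n) (rescale h) ⟩
            pow p (+ n ℤ.- + k) ℚ.+ d ℚ.- pow p (+ h ℤ.- + k) ∎) ,
          λ β β≢Lα → begin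
            fibreSize (L ∘ F) β                          ≡⟨ fibreSize-∘-off at-α′ off-α β β≢Lα ⟩
            q ℚ.* (a ℚ.- b)                              ≡⟨ solve 3 (λ q a b → q :* (a :- b) := q :* a :- q :* b) refl q a b ⟩
            q ℚ.* a ℚ.- q ℚ.* b                          ≡⟨ cong₂ ℚ._-_ (rescale n) (rescale h) ⟩
            pow p (+ n ℤ.- + k) ℚ.- pow p (+ h ℤ.- + k)  ∎
          where
          open +-*-Solver
          q = pow p (+ m ℤ.- + k)
          a = pow p (+ n ℤ.- + m)
          b = pow p (+ h ℤ.- + m)
          d = pow p (+ h)
          -- The fibre size regrouped as common size c = a - b plus excess d.
          at-α′ : fibreSize F α ≡ a ℚ.- b ℚ.+ d
          at-α′ = trans at-α (solve 3 (λ a b d → a :+ d :- b := a :- b :+ d) refl a b d)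

        almostBalanced⁻-∘ : AlmostBalanced⁻ F → AlmostBalanced⁻ (L ∘ F)
        almostBalanced⁻-∘ (F-bent , h , n≡2h , α , at-α , off-α) =
          bent-∘ F-bent , h , n≡2h , L α ,
          (begin
            fibreSize (L ∘ F) (L α)                      ≡⟨ fibreSize-∘-at at-α′ off-α ⟩
            q ℚ.* (a ℚ.+ b) ℚ.- d                        ≡⟨ solve 4 (λ q a b d → q :* (a :+ b) :- d := q :* a :- d :+ q :* b) refl q a b d ⟩
            q ℚ.* a ℚ.- d ℚ.+ q ℚ.* b                    ≡⟨ cong₂ (λ x y → x ℚ.- d ℚ.+ y) (rescale n) (rescale h) ⟩
            pow p (+ n ℤ.- + k) ℚ.- d ℚ.+ pow p (+ h ℤ.- + k) ∎) ,
          λ β β≢Lα → begin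
            fibreSize (L ∘ F) β                          ≡⟨ fibreSize-∘-off at-α′ off-α β β≢Lα ⟩
            q ℚ.* (a ℚ.+ b)                              ≡⟨ ℚ.*-distribˡ-+ q a b ⟩
            q ℚ.* a ℚ.+ q ℚ.* b                          ≡⟨ cong₂ ℚ._+_ (rescale n) (rescale h) ⟩
            pow p (+ n ℤ.- + k) ℚ.+ pow p (+ h ℤ.- + k)  ∎
          where
          open +-*-Solver
          q = pow p (+ m ℤ.- + k)
          a = pow p (+ n ℤ.- + m)
          b = pow p (+ h ℤ.- + m)
          d = pow p (+ h)
          -- Subtraction in ℚ unfolds to adding the negative, so this has the form c + d with c = a
          -- + b and excess -p^h.
          at-α′ : fibreSize F α ≡ a ℚ.+ b ℚ.- d
          at-α′ = trans at-α (solve 3 (λ a b d → a :- d :+ b := a :+ b :- d) refl a b d)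

proposition3p11 : (p : ℕ) .{{_ : NonZero p}} → Prime p →
    (n m : ℕ) (F : 𝔽 p ^ n → 𝔽 p ^ m) →
    Bent F → AlmostBalanced F → Surjective _≡_ _≡_ F →
    ((k : ℕ) (L : 𝔽 p ^ m → 𝔽 p ^ k) → IsLinear L → Surjective _≡_ _≡_ L →
    (AlmostBalanced⁺ F → AlmostBalanced⁺ (L ∘ F)) ×
    (AlmostBalanced⁻ F → AlmostBalanced⁻ (L ∘ F)))
    ×
    ((b : 𝔽 p ^ m) → b ≢ 0ᵥ →
    (AlmostBalanced⁺ F → AlmostBalanced⁺ (component F b)) ×
    (AlmostBalanced⁻ F → AlmostBalanced⁻ (component F b)))
proposition3p11 p p-prime n m F _ _ _ =
  (λ k L L-linear L-surjective →
    almostBalanced⁺-∘ L L-linear L-surjective F , almostBalanced⁻-∘ L L-linear L-surjective F) ,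
  -- Primality enters through the surjectivity of the functional. The result for `functional b ∘ F`
  -- applies as it stands, since this unfolds to `component F b`.
  λ b b≢0 → let L-linear = functional-isLinear b ; L-surjective = functional-surjective p-prime b b≢0 in
    almostBalanced⁺-∘ (functional b) L-linear L-surjective F ,
    almostBalanced⁻-∘ (functional b) L-linear L-surjective F
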